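{- Let $\mathcal{G}$ be a finite weighted coloured--edge graph with $n\ge2$ vertices and $k$ colours such that for every ordered pair of vertices $(x,y)$ and every colour $c$ there is at most one edge from $x$ to $y$ of colour $c$. Then for any vertices $u\ne v$, the number of minimal paths from $u$ to $v$ (counting all of them, including distinct paths with equal weight vectors) is at most $k(k+1)^{n-2}$.
   Context: A weighted coloured--edge graph $\mathcal{G}=\langle V,E,\omega,\lambda\rangle$ consists of a directed multigraph with vertex set $V$ and edge set $E$ (each edge $e$ has an initial vertex and a distinct terminal vertex), a weight function $\omega:E\to\mathbb{R}^+$ (strictly positive reals), and a surjective colour function $\lambda:E\to M$ onto a set $M$ of colours; $k=|M|$. A path from $u$ to $v$ is a sequence of edges $e_1,\dots,e_l$ ($l\ge1$) such that the initial vertex of $e_1$ is $u$, the terminal vertex of $e_l$ is $v$, the terminal vertex of $e_i$ is the initial vertex of $e_{i+1}$, and no vertex is visited twice. For a path $p$ and colour $c$, $\omega_c(p)$ is the sum of $\omega(e)$ over edges $e$ of $p$ with $\lambda(e)=c$. For paths $p,q$ from $u$ to $v$, $p\le q$ means $\omega_c(p)\le\omega_c(q)$ for all $c\in M$. A path $p$ from $u$ to $v$ is minimal if there is no path $q$ from $u$ to $v$ with $q\le p$ and $\omega_c(q)<\omega_c(p)$ for some colour $c$. -}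

module Defs where

open import Data.Fin.Base using (Fin)
open import Data.Fin.Properties using (_≟_)
open import Data.List.Base using (List; []; _∷_; [_]; map; filter; foldr; length)
open import Data.List.Relation.Unary.All using (All)
open import Data.List.Relation.Unary.Unique.Propositional using (Unique)
open import Data.Nat.Base as ℕ using (ℕ)
import Data.Nat.Properties as ℕ
open import Data.Product.Base using (∃; _×_; _,_)
open import Data.Rational.Base as ℚ using (ℚ; 0ℚ; 1ℚ; ½)
import Data.Rational.Properties as ℚ
open import Data.Rational.Solver using (module +-*-Solver)
open import Function.Definitions using (StrictlySurjective)
open import Relation.Binary.PropositionalEquality
  using (_≡_; _≢_; refl; sym; trans; cong; subst; subst₂)
open import Relation.Nullary.Negation.Core using (¬_)

------------------------------------------------------------------------
-- Real numbers, as Cauchy sequences of rationals. Only the order and the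
-- addition are needed. Real-number equality is x ≤ᴿ y × y ≤ᴿ x, not _≡_.

IsCauchy : (ℕ → ℚ) → Set
IsCauchy x = ∀ ε → 0ℚ ℚ.< ε →
  ∃ λ N → ∀ i j → N ℕ.≤ i → N ℕ.≤ j → ℚ.∣ x i ℚ.- x j ∣ ℚ.< ε

record ℝ : Set where
  constructor mkℝ
  field
    seq    : ℕ → ℚ
    cauchy : IsCauchy seq

open ℝ public

infix  4 _<ᴿ_ _≤ᴿ_
infixl 6 _+ᴿ_

_<ᴿ_ : ℝ → ℝ → Set
x <ᴿ y = ∃ λ ε → 0ℚ ℚ.< ε ×
  ∃ λ N → ∀ i → N ℕ.≤ i → seq x i ℚ.+ ε ℚ.≤ seq y i

_≤ᴿ_ : ℝ → ℝ → Set
x ≤ᴿ y = ¬ (y <ᴿ x)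

0ᴿ : ℝ
0ᴿ = mkℝ (λ _ → 0ℚ) (λ ε 0<ε → 0 , λ _ _ _ _ → 0<ε)

private
  half-positive : ∀ {ε} → 0ℚ ℚ.< ε → 0ℚ ℚ.< ½ ℚ.* ε
  half-positive {ε} 0<ε = subst (ℚ._< ½ ℚ.* ε) (ℚ.*-zeroʳ ½) (ℚ.*-monoʳ-<-pos ½ 0<ε)

  halves : ∀ ε → ½ ℚ.* ε ℚ.+ ½ ℚ.* ε ≡ ε
  halves ε = trans (sym (ℚ.*-distribʳ-+ ε ½ ½)) (ℚ.*-identityˡ ε)

  interchange : ∀ a b c d →
    (a ℚ.- c) ℚ.+ (b ℚ.- d) ≡ (a ℚ.+ b) ℚ.- (c ℚ.+ d)
  interchange = solve 4 (λ a b c d →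
    (a :- c) :+ (b :- d) := (a :+ b) :- (c :+ d)) refl
    where open +-*-Solver

_+ᴿ_ : ℝ → ℝ → ℝ
x +ᴿ y = mkℝ (λ i → seq x i ℚ.+ seq y i) +-cauchy
  where
  +-cauchy : IsCauchy (λ i → seq x i ℚ.+ seq y i)
  +-cauchy ε 0<ε with cauchy x (½ ℚ.* ε) (half-positive 0<ε)
                    | cauchy y (½ ℚ.* ε) (half-positive 0<ε)
  ... | N₁ , close₁ | N₂ , close₂ = N₁ ℕ.⊔ N₂ , λ i j N≤i N≤j →
    subst₂ (λ s t → ℚ.∣ s ∣ ℚ.< t)
      (interchange (seq x i) (seq y i) (seq x j) (seq y j))
      (halves ε)
      (ℚ.≤-<-trans
        (ℚ.∣p+q∣≤∣p∣+∣q∣ (seq x i ℚ.- seq x j) (seq y i ℚ.- seq y j))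
        (ℚ.+-mono-<
          (close₁ i j (ℕ.m⊔n≤o⇒m≤o N₁ N₂ N≤i) (ℕ.m⊔n≤o⇒m≤o N₁ N₂ N≤j))
          (close₂ i j (ℕ.m⊔n≤o⇒n≤o N₁ N₂ N≤i) (ℕ.m⊔n≤o⇒n≤o N₁ N₂ N≤j))))

sumᴿ : List ℝ → ℝ
sumᴿ = foldr _+ᴿ_ 0ᴿ

------------------------------------------------------------------------
-- Finite weighted coloured-edge graphs with n vertices, m edges and k
-- colours.

record WeightedColouredGraph (n m k : ℕ) : Set where
  field
    source target     : Fin m → Fin n
    source≢target     : ∀ e → source e ≢ target e
    weight            : Fin m → ℝ
    weight-positive   : ∀ e → 0ᴿ <ᴿ weight e
    colour            : Fin m → Fin k
    colour-surjective : StrictlySurjective _≡_ colour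

module _ {n m k : ℕ} (G : WeightedColouredGraph n m k) where
  open WeightedColouredGraph G

  AtMostOneEdgePerColour : Set
  AtMostOneEdgePerColour = ∀ (x y : Fin n) (c : Fin k) (e f : Fin m) →
    source e ≡ x → target e ≡ y → colour e ≡ c →
    source f ≡ x → target f ≡ y → colour f ≡ c →
    e ≡ f

  data IsWalk : Fin n → Fin n → List (Fin m) → Set where
    last : ∀ {u v e} → source e ≡ u → target e ≡ v → IsWalk u v [ e ]
    step : ∀ {u v e es} → source e ≡ u → IsWalk (target e) v es → IsWalk u v (e ∷ es)

  -- The vertices visited by a walk starting at u, in order.
  visited : Fin n → List (Fin m) → List (Fin n)
  visited u es = u ∷ map target es

  IsPath : Fin n → Fin n → List (Fin m) → Set
  IsPath u v p = IsWalk u v p × Unique (visited u p)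

  colourWeight : Fin k → List (Fin m) → ℝ
  colourWeight c p = sumᴿ (map weight (filter (λ e → colour e ≟ c) p))

  _≼_ : List (Fin m) → List (Fin m) → Set
  p ≼ q = ∀ c → colourWeight c p ≤ᴿ colourWeight c q

  IsMinimalPath : Fin n → Fin n → List (Fin m) → Set
  IsMinimalPath u v p = IsPath u v p ×
    ¬ (∃ λ q → IsPath u v q × q ≼ p × ∃ λ c → colourWeight c q <ᴿ colourWeight c p)

-- The subset P has at most N elements. Phrased without a cardinality function,
-- as minimality of a path is not decidable for real weights.
HasAtMost : {A : Set} → ℕ → (A → Set) → Set
HasAtMost {A} N P = ∀ (xs : List A) → Unique xs → All P xs → length xs ℕ.≤ N

{-# OPTIONS --safe #-}

-- A minimal path is determined by its outgoing colours, i.e. by the function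
-- taking each vertex to the colour of the edge by which the path leaves it (if
-- any). Suppose two minimal paths with the same outgoing colours first diverge
-- at x, along edges a and b of the same colour with weight a ≤ weight b. Since
-- both paths visit the same vertices, target a lies on the path through b, and
-- strictly after target b. Replacing everything between x and target a by the
-- single edge a makes that path strictly smaller, a contradiction.
-- There are k choices of colour at u and suc k at each of the n ∸ 2 vertices
-- other than u and v.

module Submission where

open import Defs
open import Data.Nat.Base as ℕ using (ℕ; suc; _≤_; _*_; _^_; _∸_; _⊔_)
import Data.Nat.Properties as ℕ
open import Data.Fin.Base as Fin using (Fin; punchIn; punchOut; combine; funToFin; finToFun)
open import Data.Fin.Properties as Fin using (_≟_)
open import Data.List.Base using (List; []; _∷_; _++_; foldr; map; filter; lookup)
open import Data.List.Properties using (map-++; ≡-dec)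
open import Data.List.Membership.Propositional using (_∈_)
open import Data.List.Membership.Propositional.Properties
  using (∈-map⁻; ∈-∃++; ∈-++⁺ʳ; ∈-lookup)
open import Data.List.Relation.Binary.Subset.Propositional using (_⊆_)
open import Data.List.Relation.Unary.All as All using (All; []; _∷_)
import Data.List.Relation.Unary.All.Properties as All
open import Data.List.Relation.Unary.AllPairs using ([]; _∷_)
open import Data.List.Relation.Unary.Any using (here; there)
open import Data.List.Relation.Unary.Unique.Propositional using (Unique)
open import Data.Product.Base using (∃; ∃₂; _×_; _,_; proj₁; proj₂)
open import Data.Rational.Base as ℚ using (ℚ; 0ℚ; ½)
import Data.Rational.Properties as ℚ
open import Data.Rational.Solver using (module +-*-Solver)
open import Data.Sum.Base using (inj₁; inj₂)
open import Function.Base using (_∘_)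
open import Relation.Binary.PropositionalEquality
  using (_≡_; _≢_; refl; sym; trans; cong; subst; module ≡-Reasoning)
open import Relation.Nullary.Decidable using (yes; no; decidable-stable)
open import Relation.Nullary.Negation using (¬_; contradiction)

-- Order on the Cauchy reals

half-positive : ∀ {ε} → 0ℚ ℚ.< ε → 0ℚ ℚ.< ½ ℚ.* ε
half-positive {ε} 0<ε = subst (ℚ._< ½ ℚ.* ε) (ℚ.*-zeroʳ ½) (ℚ.*-monoʳ-<-pos ½ 0<ε)

p<q⇒0<q-p : ∀ {p q} → p ℚ.< q → 0ℚ ℚ.< q ℚ.- p
p<q⇒0<q-p {p} {q} p<q = subst (ℚ._< q ℚ.- p) (ℚ.+-inverseʳ p) (ℚ.+-monoˡ-< (ℚ.- p) p<q)

p≤p+ε : ∀ p {ε} → 0ℚ ℚ.< ε → p ℚ.≤ p ℚ.+ ε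
p≤p+ε p {ε} 0<ε = subst (ℚ._≤ p ℚ.+ ε) (ℚ.+-identityʳ p) (ℚ.+-monoʳ-≤ p (ℚ.<⇒≤ 0<ε))

p≤∣p∣ : ∀ p → p ℚ.≤ ℚ.∣ p ∣
p≤∣p∣ p with ℚ.≤-total 0ℚ p
... | inj₁ 0≤p = ℚ.≤-reflexive (sym (ℚ.0≤p⇒∣p∣≡p 0≤p))
... | inj₂ p≤0 = ℚ.≤-trans p≤0 (ℚ.0≤∣p∣ p)

∣p-q∣<ε⇒p≤q+ε : ∀ p q {ε} → ℚ.∣ p ℚ.- q ∣ ℚ.< ε → p ℚ.≤ q ℚ.+ ε
∣p-q∣<ε⇒p≤q+ε p q {ε} close = begin
  p                ≡⟨ solve 2 (λ p q → p := q :+ (p :- q)) refl p q ⟩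
  q ℚ.+ (p ℚ.- q)  ≤⟨ ℚ.+-monoʳ-≤ q (ℚ.≤-trans (p≤∣p∣ (p ℚ.- q)) (ℚ.<⇒≤ close)) ⟩
  q ℚ.+ ε          ∎
  where open ℚ.≤-Reasoning
        open +-*-Solver

infix 4 _⊑_

-- Equivalent to _≤ᴿ_, but in a positive form that can be added up.
_⊑_ : ℝ → ℝ → Set
x ⊑ y = ∀ ε → 0ℚ ℚ.< ε → ∃ λ N → ∀ i → N ≤ i → seq x i ℚ.≤ seq y i ℚ.+ ε

⊑-refl : ∀ {x} → x ⊑ x
⊑-refl {x} ε 0<ε = 0 , λ i _ → p≤p+ε (seq x i) 0<ε

<⇒⊑ : ∀ {x y} → x <ᴿ y → x ⊑ y
<⇒⊑ {x} {y} (δ , 0<δ , N , x+δ≤y) ε 0<ε = N , λ i N≤i →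
  ℚ.≤-trans (p≤p+ε (seq x i) 0<δ) (ℚ.≤-trans (x+δ≤y i N≤i) (p≤p+ε (seq y i) 0<ε))

⊑-trans : ∀ {x y z} → x ⊑ y → y ⊑ z → x ⊑ z
⊑-trans {x} {y} {z} x⊑y y⊑z ε 0<ε
  with N , bound₁ ← x⊑y (½ ℚ.* ε) (half-positive 0<ε)
     | M , bound₂ ← y⊑z (½ ℚ.* ε) (half-positive 0<ε)
  = N ⊔ M , λ i N⊔M≤i → begin
    seq x i
      ≤⟨ bound₁ i (ℕ.m⊔n≤o⇒m≤o N M N⊔M≤i) ⟩
    seq y i ℚ.+ ½ ℚ.* ε
      ≤⟨ ℚ.+-monoˡ-≤ (½ ℚ.* ε) (bound₂ i (ℕ.m⊔n≤o⇒n≤o N M N⊔M≤i)) ⟩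
    (seq z i ℚ.+ ½ ℚ.* ε) ℚ.+ ½ ℚ.* ε
      ≡⟨ solve 2 (λ z ε → (z :+ con ½ :* ε) :+ con ½ :* ε := z :+ ε) refl (seq z i) ε ⟩
    seq z i ℚ.+ ε ∎
  where open ℚ.≤-Reasoning
        open +-*-Solver

+-mono-⊑ : ∀ {x y a b} → x ⊑ y → a ⊑ b → x +ᴿ a ⊑ y +ᴿ b
+-mono-⊑ {x} {y} {a} {b} x⊑y a⊑b ε 0<ε
  with N , bound₁ ← x⊑y (½ ℚ.* ε) (half-positive 0<ε)
     | M , bound₂ ← a⊑b (½ ℚ.* ε) (half-positive 0<ε)
  = N ⊔ M , λ i N⊔M≤i → begin
    seq x i ℚ.+ seq a i
      ≤⟨ ℚ.+-mono-≤ (bound₁ i (ℕ.m⊔n≤o⇒m≤o N M N⊔M≤i)) (bound₂ i (ℕ.m⊔n≤o⇒n≤o N M N⊔M≤i)) ⟩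
    (seq y i ℚ.+ ½ ℚ.* ε) ℚ.+ (seq b i ℚ.+ ½ ℚ.* ε)
      ≡⟨ solve 3 (λ y b ε → (y :+ con ½ :* ε) :+ (b :+ con ½ :* ε) := (y :+ b) :+ ε)
           refl (seq y i) (seq b i) ε ⟩
    (seq y i ℚ.+ seq b i) ℚ.+ ε ∎
  where open ℚ.≤-Reasoning
        open +-*-Solver

<-⊑-trans : ∀ {x y z} → x <ᴿ y → y ⊑ z → x <ᴿ z
<-⊑-trans {x} {y} {z} (δ , 0<δ , N , bound₁) y⊑z
  with M , bound₂ ← y⊑z (½ ℚ.* δ) (half-positive 0<δ)
  -- Half of the gap `δ` absorbs the error in `y⊑z`; the other half is the new gap.
  = ½ ℚ.* δ , half-positive 0<δ , N ⊔ M , λ i N⊔M≤i → begin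
    seq x i ℚ.+ ½ ℚ.* δ
      ≡⟨ solve 2 (λ x δ → x :+ con ½ :* δ := (x :+ δ) :- con ½ :* δ) refl (seq x i) δ ⟩
    (seq x i ℚ.+ δ) ℚ.- ½ ℚ.* δ
      ≤⟨ ℚ.+-monoˡ-≤ (ℚ.- (½ ℚ.* δ)) (ℚ.≤-trans
           (bound₁ i (ℕ.m⊔n≤o⇒m≤o N M N⊔M≤i)) (bound₂ i (ℕ.m⊔n≤o⇒n≤o N M N⊔M≤i))) ⟩
    (seq z i ℚ.+ ½ ℚ.* δ) ℚ.- ½ ℚ.* δ
      ≡⟨ solve 2 (λ z δ → (z :+ con ½ :* δ) :- con ½ :* δ := z) refl (seq z i) δ ⟩
    seq z i ∎
  where open ℚ.≤-Reasoning
        open +-*-Solver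

+-monoʳ-<ᴿ : ∀ x {a b} → a <ᴿ b → x +ᴿ a <ᴿ x +ᴿ b
+-monoʳ-<ᴿ x {a} {b} (δ , 0<δ , N , bound) = δ , 0<δ , N , λ i N≤i →
  subst (ℚ._≤ seq x i ℚ.+ seq b i) (sym (ℚ.+-assoc (seq x i) (seq a i) δ))
    (ℚ.+-monoʳ-≤ (seq x i) (bound i N≤i))

x<ᴿy+x : ∀ x {y} → 0ᴿ <ᴿ y → x <ᴿ y +ᴿ x
x<ᴿy+x x {y} (δ , 0<δ , N , bound) = δ , 0<δ , N , λ i N≤i →
  subst (ℚ._≤ seq y i ℚ.+ seq x i)
    (trans (cong (ℚ._+ seq x i) (ℚ.+-identityˡ δ)) (ℚ.+-comm δ (seq x i)))
    (ℚ.+-monoˡ-≤ (seq x i) (bound i N≤i))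

<ᴿ-irrefl : ∀ {x} → ¬ (x <ᴿ x)
<ᴿ-irrefl {x} (δ , 0<δ , N , bound) = ℚ.<-irrefl refl (ℚ.<-≤-trans
  (subst (ℚ._< seq x N ℚ.+ δ) (ℚ.+-identityʳ (seq x N)) (ℚ.+-monoʳ-< (seq x N) 0<δ))
  (bound N ℕ.≤-refl))

⊑⇒≤ᴿ : ∀ {x y} → x ⊑ y → x ≤ᴿ y
⊑⇒≤ᴿ {x} {y} x⊑y y<x = <ᴿ-irrefl {y} (<-⊑-trans {y} {x} {y} y<x x⊑y)

-- Compare x and y at a single index N beyond which both oscillate by at most ε / 4.
≤ᴿ⇒⊑ : ∀ {x y} → x ≤ᴿ y → x ⊑ y
≤ᴿ⇒⊑ {x} {y} x≤y ε 0<ε = compare (cauchy x η 0<η) (cauchy y η 0<η)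
  where
  open ℚ.≤-Reasoning
  open +-*-Solver

  η : ℚ
  η = ½ ℚ.* (½ ℚ.* ε)

  0<η : 0ℚ ℚ.< η
  0<η = half-positive (half-positive 0<ε)

  TailCloseTo : ℝ → ℕ → Set
  TailCloseTo z N = ∀ i j → N ≤ i → N ≤ j → ℚ.∣ seq z i ℚ.- seq z j ∣ ℚ.< η

  compare : ∃ (TailCloseTo x) → ∃ (TailCloseTo y) →
    ∃ λ N → ∀ i → N ≤ i → seq x i ℚ.≤ seq y i ℚ.+ ε
  compare (N₁ , close₁) (N₂ , close₂) = N , bound
    where
    N : ℕ
    N = N₁ ⊔ N₂

    x-close : ∀ i j → N ≤ i → N ≤ j → seq x i ℚ.≤ seq x j ℚ.+ η
    x-close i j N≤i N≤j = ∣p-q∣<ε⇒p≤q+ε (seq x i) (seq x j)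
      (close₁ i j (ℕ.m⊔n≤o⇒m≤o N₁ N₂ N≤i) (ℕ.m⊔n≤o⇒m≤o N₁ N₂ N≤j))

    y-close : ∀ i j → N ≤ i → N ≤ j → seq y i ℚ.≤ seq y j ℚ.+ η
    y-close i j N≤i N≤j = ∣p-q∣<ε⇒p≤q+ε (seq y i) (seq y j)
      (close₂ i j (ℕ.m⊔n≤o⇒n≤o N₁ N₂ N≤i) (ℕ.m⊔n≤o⇒n≤o N₁ N₂ N≤j))

    at-N : seq x N ℚ.≤ seq y N ℚ.+ (η ℚ.+ η)
    -- Each sequence moves by less than `η` after `N`, so an excess over `η + η` would persist as a
    -- positive gap and give `y <ᴿ x`.
    at-N = ℚ.≮⇒≥ λ y+2η<x →
      let z = seq y N ℚ.+ (η ℚ.+ η) in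
      x≤y (seq x N ℚ.- z , p<q⇒0<q-p y+2η<x , N , λ i N≤i → begin
        seq y i ℚ.+ (seq x N ℚ.- z)
          ≤⟨ ℚ.+-mono-≤ (y-close i N N≤i ℕ.≤-refl)
               (ℚ.+-monoˡ-≤ (ℚ.- z) (x-close N i ℕ.≤-refl N≤i)) ⟩
        (seq y N ℚ.+ η) ℚ.+ ((seq x i ℚ.+ η) ℚ.- z)
          ≡⟨ solve 3 (λ y x η → (y :+ η) :+ ((x :+ η) :- (y :+ (η :+ η))) := x)
               refl (seq y N) (seq x i) η ⟩
        seq x i ∎)

    bound : ∀ i → N ≤ i → seq x i ℚ.≤ seq y i ℚ.+ ε
    bound i N≤i = begin
      seq x i
        ≤⟨ x-close i N N≤i ℕ.≤-refl ⟩
      seq x N ℚ.+ η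
        ≤⟨ ℚ.+-monoˡ-≤ η at-N ⟩
      (seq y N ℚ.+ (η ℚ.+ η)) ℚ.+ η
        ≤⟨ ℚ.+-monoˡ-≤ η (ℚ.+-monoˡ-≤ (η ℚ.+ η) (y-close N i ℕ.≤-refl N≤i)) ⟩
      ((seq y i ℚ.+ η) ℚ.+ (η ℚ.+ η)) ℚ.+ η
        ≡⟨ solve 2 (λ y ε → let η = con ½ :* (con ½ :* ε) in
             ((y :+ η) :+ (η :+ η)) :+ η := y :+ ε) refl (seq y i) ε ⟩
      seq y i ℚ.+ ε ∎

-- Lists

module _ {A : Set} where

  Unique-++⁻ʳ : ∀ (xs : List A) {ys} → Unique (xs ++ ys) → Unique ys
  Unique-++⁻ʳ []       uniq       = uniq
  Unique-++⁻ʳ (_ ∷ xs) (_ ∷ uniq) = Unique-++⁻ʳ xs uniq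

  lookup-injective : ∀ {xs : List A} → Unique xs → ∀ {i j} → lookup xs i ≡ lookup xs j → i ≡ j
  lookup-injective (_ ∷ _) {Fin.zero} {Fin.zero} _ = refl
  lookup-injective (x∉xs ∷ _) {Fin.zero} {Fin.suc j} eq =
    contradiction eq (All.lookup x∉xs (∈-lookup j))
  lookup-injective (x∉xs ∷ _) {Fin.suc i} {Fin.zero} eq =
    contradiction (sym eq) (All.lookup x∉xs (∈-lookup i))
  lookup-injective (_ ∷ uniq) {Fin.suc i} {Fin.suc j} eq = cong Fin.suc (lookup-injective uniq eq)

  -- The indices of a duplicate-free list embed into `Fin N`. The code may depend on the proof of
  -- `P x`; only the element has to be recovered.
  injective-code⇒HasAtMost : ∀ {N} {P : A → Set} (code : ∀ {x} → P x → Fin N) →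
    (∀ {x y} (px : P x) (py : P y) → code px ≡ code py → x ≡ y) → HasAtMost N P
  injective-code⇒HasAtMost code code-injective xs uniq all =
    Fin.injective⇒≤ {f = λ i → code (All.lookup all (∈-lookup i))}
      λ eq → lookup-injective uniq (code-injective _ _ eq)

-- Abstract in the weights: conversion checking on concrete sums of reals would
-- unfold the proofs that they are Cauchy.
module ColourWeight {m k : ℕ} {R : Set}
  (_+_ : R → R → R) (0# : R) (_⊑_ _<_ : R → R → Set)
  (⊑-refl    : ∀ {x} → x ⊑ x)
  (⊑-trans   : ∀ {x y z} → x ⊑ y → y ⊑ z → x ⊑ z)
  (<⇒⊑       : ∀ {x y} → x < y → x ⊑ y)
  (<-⊑-trans : ∀ {x y z} → x < y → y ⊑ z → x < z)
  (+-mono-⊑  : ∀ {x y a b} → x ⊑ y → a ⊑ b → (x + a) ⊑ (y + b))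
  (+-monoʳ-< : ∀ x {a b} → a < b → (x + a) < (x + b))
  (colour : Fin m → Fin k) (weight : Fin m → R)
  (weight-increases : ∀ e x → x < (weight e + x))
  where

  weightOf : Fin k → List (Fin m) → R
  weightOf c p = foldr _+_ 0# (map weight (filter (λ e → colour e ≟ c) p))

  -- With equal colours the two filters keep both heads or drop both.
  ∷-mono-⊑ : ∀ c {a b} s t → colour a ≡ colour b → weight a ⊑ weight b →
    weightOf c s ⊑ weightOf c t → weightOf c (a ∷ s) ⊑ weightOf c (b ∷ t)
  ∷-mono-⊑ c {a} {b} s t eq a⊑b s⊑t with colour a | colour b | eq
  ... | d | .d | refl with d ≟ c
  ... | yes _ = +-mono-⊑ a⊑b s⊑t
  ... | no  _ = s⊑t

  ∷-mono-< : ∀ c {a b} s t → colour a ≡ colour b → weight a ⊑ weight b →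
    weightOf c s < weightOf c t → weightOf c (a ∷ s) < weightOf c (b ∷ t)
  ∷-mono-< c {a} {b} s t eq a⊑b s<t with colour a | colour b | eq
  ... | d | .d | refl with d ≟ c
  ... | yes _ = <-⊑-trans (+-monoʳ-< (weight a) s<t) (+-mono-⊑ a⊑b ⊑-refl)
  ... | no  _ = s<t

  tail-< : ∀ e es → weightOf (colour e) es < weightOf (colour e) (e ∷ es)
  tail-< e es with colour e ≟ colour e
  ... | yes _  = weight-increases e _
  ... | no neq = contradiction refl neq

  tail-⊑ : ∀ c e es → weightOf c es ⊑ weightOf c (e ∷ es)
  tail-⊑ c e es with colour e ≟ c
  ... | yes _ = <⇒⊑ (weight-increases e _)
  ... | no  _ = ⊑-refl

  suffix-⊑ : ∀ c ds es → weightOf c es ⊑ weightOf c (ds ++ es)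
  suffix-⊑ c []       es = ⊑-refl
  suffix-⊑ c (d ∷ ds) es = ⊑-trans (suffix-⊑ c ds es) (tail-⊑ c d (ds ++ es))

  -- In a shortcut, `f` is the last edge removed and `es` the part that is kept.
  later-suffix-⊑ : ∀ c ds f es → weightOf c es ⊑ weightOf c (ds ++ f ∷ es)
  later-suffix-⊑ c ds f es = ⊑-trans (tail-⊑ c f es) (suffix-⊑ c ds (f ∷ es))

  later-suffix-< : ∀ ds f es → weightOf (colour f) es < weightOf (colour f) (ds ++ f ∷ es)
  later-suffix-< ds f es = <-⊑-trans (tail-< f es) (suffix-⊑ (colour f) ds (f ∷ es))

module _ {n m k : ℕ} (G : WeightedColouredGraph n m k) where
  open WeightedColouredGraph G

  open ColourWeight _+ᴿ_ 0ᴿ _⊑_ _<ᴿ_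
    (λ {x} → ⊑-refl {x})
    (λ {x} {y} {z} → ⊑-trans {x} {y} {z})
    (λ {x} {y} → <⇒⊑ {x} {y})
    (λ {x} {y} {z} → <-⊑-trans {x} {y} {z})
    (λ {x} {y} {a} {b} → +-mono-⊑ {x} {y} {a} {b})
    (λ x {a} {b} → +-monoʳ-<ᴿ x {a} {b})
    colour weight
    (λ e x → x<ᴿy+x x {weight e} (weight-positive e))

  -- Walks and paths

  target-∈ : ∀ {u v es} → IsWalk G u v es → v ∈ map target es
  target-∈ (last _ refl) = here refl
  target-∈ (step _ walk) = there (target-∈ walk)

  source-∈ : ∀ {u v es e} → IsWalk G u v es → e ∈ es → source e ∈ visited G u es
  source-∈ (last src _)    (here refl) = here src
  source-∈ (step src _)    (here refl) = here src
  source-∈ (step _ walk)   (there e∈es) = there (source-∈ walk e∈es)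

  -- The end is the target of `e` or of a later edge, and a path does not return to a vertex it has
  -- left.
  source≢end : ∀ {u v es e} → IsPath G u v es → e ∈ es → source e ≢ v
  source≢end (walk@(last refl _) , u∉ ∷ _) (here refl) = All.lookup u∉ (target-∈ walk)
  source≢end (walk@(step refl _) , u∉ ∷ _) (here refl) = All.lookup u∉ (target-∈ walk)
  source≢end (step _ walk , _ ∷ uniq) (there e∈es) = source≢end (walk , uniq) e∈es

  source≢start : ∀ {u v e es f} → IsPath G u v (e ∷ es) → f ∈ es → source f ≢ u
  source≢start (step _ walk , u∉ ∷ _) f∈es eq = All.lookup u∉ (source-∈ walk f∈es) (sym eq)

  source-head : ∀ {u v e es} → IsWalk G u v (e ∷ es) → source e ≡ u
  source-head (last src _) = src
  source-head (step src _) = src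

  shortcut : ∀ {x y v a} ds {f es} → source a ≡ x → target a ≡ target f →
    IsWalk G y v (ds ++ f ∷ es) → IsWalk G x v (a ∷ es)
  shortcut [] src tgt (last _ end)  = last src (trans tgt end)
  shortcut [] src tgt (step _ walk) = step src (subst (λ z → IsWalk G z _ _) (sym tgt) walk)
  -- Splitting on the rest of `ds` exposes a second edge, which excludes `last`.
  shortcut (_ ∷ [])         src tgt (step _ walk) = shortcut [] src tgt walk
  shortcut (_ ∷ ds@(_ ∷ _)) src tgt (step _ walk) = shortcut ds src tgt walk

  -- Opaque, as normalising colour weights is expensive. The inclusion of vertex
  -- sets lets an improvement be prefixed by an edge.
  opaque
    Improvable : Fin n → Fin n → List (Fin m) → Set
    Improvable u v p = ∃ λ q → IsPath G u v q × map target q ⊆ map target p ×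
      (∀ c → colourWeight G c q ⊑ colourWeight G c p) ×
      ∃ λ c → colourWeight G c q <ᴿ colourWeight G c p

    minimal⇒¬improvable : ∀ {u v p} → IsMinimalPath G u v p → ¬ Improvable u v p
    minimal⇒¬improvable {p = p} (_ , minimal) (q , path , _ , q⊑p , q<p) =
      minimal (q , path , (λ c → ⊑⇒≤ᴿ {colourWeight G c q} {colourWeight G c p} (q⊑p c)) , q<p)

    improvable-∷ : ∀ {u v e es} → IsPath G u v (e ∷ es) →
      Improvable (target e) v es → Improvable u v (e ∷ es)
    improvable-∷ {e = e} {es} (walk , (u≢ ∷ u∉) ∷ _) (q , (walk′ , uniq) , q⊆ , q⊑ , c , q<) =
      e ∷ q ,
      (step (source-head walk) walk′ , (u≢ ∷ All.tabulate (λ y∈ → All.lookup u∉ (q⊆ y∈))) ∷ uniq) ,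
      (λ { (here eq) → here eq ; (there y∈) → there (q⊆ y∈) }) ,
      (λ c → ∷-mono-⊑ c q es refl (⊑-refl {weight e}) (q⊑ c)) ,
      c , ∷-mono-< c q es refl (⊑-refl {weight e}) q<

    -- The edge `a` replaces everything from `b` through `f`. It is no heavier than `b` in their
    -- common colour, and the loss of `f` makes the decrease strict in the colour of `f`.
    shortcut-improves : ∀ {u v b} ds {a f es} → IsPath G u v (b ∷ ds ++ f ∷ es) →
      source a ≡ u → target a ≡ target f → colour a ≡ colour b → weight a ⊑ weight b →
      Improvable u v (b ∷ ds ++ f ∷ es)
    shortcut-improves {u} {v} {b} ds {a} {f} {es} (walk , (_ ∷ u∉) ∷ _ ∷ uniq) src tgt col a⊑b =
      a ∷ es ,
      (shortcut (b ∷ ds) src tgt walk ,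
        -- The targets of `a ∷ es` are those of `f ∷ es`, a suffix of the old vertex list, so they
        -- stay distinct and avoid `u`.
        subst (λ ys → Unique (u ∷ ys)) tgts
          (All.++⁻ʳ (map target ds) (subst (All (u ≢_)) split u∉) ∷
           Unique-++⁻ʳ (map target ds) (subst Unique split uniq))) ,
      (λ {y} y∈ → there (subst (y ∈_) (sym split)
        (∈-++⁺ʳ (map target ds) (subst (y ∈_) (sym tgts) y∈)))) ,
      (λ c → ∷-mono-⊑ c es t col a⊑b (later-suffix-⊑ c ds f es)) ,
      colour f , ∷-mono-< (colour f) es t col a⊑b (later-suffix-< ds f es)
      where
      t : List (Fin m)
      t = ds ++ f ∷ es
      split : map target t ≡ map target ds ++ map target (f ∷ es)
      split = map-++ target ds (f ∷ es)
      tgts : map target (f ∷ es) ≡ map target (a ∷ es)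
      tgts = cong (_∷ map target es) (sym tgt)

  -- Every edge of p is matched by one of q with the same source and colour.
  _⊆ᵒ_ : List (Fin m) → List (Fin m) → Set
  p ⊆ᵒ q = ∀ {e} → e ∈ p → ∃ λ f → f ∈ q × source f ≡ source e × colour f ≡ colour e

  -- Only the first edge of a path leaves its start, so `e` cannot match an edge of `p`.
  ⊆ᵒ-tail : ∀ {u v e p q} → IsPath G u v (e ∷ p) → (e ∷ p) ⊆ᵒ (e ∷ q) → p ⊆ᵒ q
  ⊆ᵒ-tail path sub g∈p with sub (there g∈p)
  ... | f , there f∈q , src , col = f , f∈q , src , col
  ... | _ , here refl , src , _ =
    contradiction (trans (sym src) (source-head (proj₁ path))) (source≢start path g∈p)

  ⊆ᵒ-head-colour : ∀ {u v a b s t} → IsPath G u v (a ∷ s) → IsPath G u v (b ∷ t) →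
    (a ∷ s) ⊆ᵒ (b ∷ t) → colour a ≡ colour b
  ⊆ᵒ-head-colour path path′ sub with sub (here refl)
  ... | _ , here refl , _ , col = sym col
  ... | f , there f∈t , src , _ =
    contradiction (trans src (source-head (proj₁ path))) (source≢start path′ f∈t)

  -- Either `a` ends at `v`, which the other walk also reaches, or the next edge leaves `target a`
  -- and its match leaves the same vertex.
  target-head-∈ : ∀ {u v a b s t} → IsWalk G u v (a ∷ s) → IsWalk G u v (b ∷ t) →
    (a ∷ s) ⊆ᵒ (b ∷ t) → target a ∈ visited G u (b ∷ t)
  target-head-∈ (last _ refl) walk′ sub = there (target-∈ walk′)
  target-head-∈ (step _ walk@(last src _)) walk′ sub with sub (there (here refl))
  ... | f , f∈ , src′ , _ = subst (_∈ _) (trans src′ src) (source-∈ walk′ f∈)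
  target-head-∈ (step _ walk@(step src _)) walk′ sub with sub (there (here refl))
  ... | f , f∈ , src′ , _ = subst (_∈ _) (trans src′ src) (source-∈ walk′ f∈)

  -- Uniqueness of a minimal path with given outgoing colours

  module _ (simple : AtMostOneEdgePerColour G) where

    divergence-improvable : ∀ {u v a b s t} → IsPath G u v (a ∷ s) → IsPath G u v (b ∷ t) →
      (a ∷ s) ⊆ᵒ (b ∷ t) → a ≢ b → weight a ⊑ weight b → Improvable u v (b ∷ t)
    divergence-improvable {u} {a = a} {b} path@(walk , (u≢ ∷ _) ∷ _) path′@(walk′ , _) sub a≢b a⊑b
      with target-head-∈ walk walk′ sub
    ... | here eq = contradiction (sym eq) u≢
    -- Edges with the same ends and colour coincide, against `a≢b`.
    ... | there (here eq) = contradiction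
      (simple u (target b) (colour b) a b (source-head walk) eq (⊆ᵒ-head-colour path path′ sub)
        (source-head walk′) refl refl) a≢b
    -- Here `f` is the edge by which the path through `b` enters `target a`.
    ... | there (there ta∈t) with f , f∈t , tgt ← ∈-map⁻ target ta∈t
      with ds , es , refl ← ∈-∃++ f∈t =
      shortcut-improves ds path′ (source-head walk) tgt (⊆ᵒ-head-colour path path′ sub) a⊑b

    -- The order of real weights is not decidable, so both conditional improvements are returned and
    -- the choice is left open.
    diverge : ∀ {u v p q} → IsPath G u v p → IsPath G u v q → p ⊆ᵒ q → q ⊆ᵒ p → p ≢ q →
      ∃₂ λ a b → (weight a ⊑ weight b → Improvable u v q) × (weight b ⊑ weight a → Improvable u v p)
    diverge {p = a ∷ s} {b ∷ t} path path′ sub sub′ p≢q with a ≟ b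
    ... | no a≢b = a , b ,
      divergence-improvable path path′ sub a≢b , divergence-improvable path′ path sub′ (a≢b ∘ sym)
    diverge path@(last _ _ , _) path′@(last _ _ , _) _ _ p≢q | yes refl = contradiction refl p≢q
    -- If one path stops after the common edge, the other would have to return to `v`.
    diverge (last _ refl , _) (step _ walk , _ ∷ v∉ ∷ _) _ _ _ | yes refl =
      contradiction refl (All.lookup v∉ (target-∈ walk))
    diverge (step _ walk , _ ∷ v∉ ∷ _) (last _ refl , _) _ _ _ | yes refl =
      contradiction refl (All.lookup v∉ (target-∈ walk))
    diverge {p = a ∷ _} path@(step _ walk , _ ∷ uniq) path′@(step _ walk′ , _ ∷ uniq′) sub sub′ p≢q
      | yes refl
      with a′ , b′ , improve , improve′ ← diverge (walk , uniq) (walk′ , uniq′)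
             (⊆ᵒ-tail path sub) (⊆ᵒ-tail path′ sub′) (p≢q ∘ cong (a ∷_))
      = a′ , b′ , improvable-∷ path′ ∘ improve , improvable-∷ path ∘ improve′

    minimal-unique : ∀ {u v p q} → IsMinimalPath G u v p → IsMinimalPath G u v q →
      p ⊆ᵒ q → q ⊆ᵒ p → p ≡ q
    minimal-unique {p = p} {q} min@(path , _) min′@(path′ , _) sub sub′ =
      -- Equality of edge lists is decidable, so a refutation of `p ≢ q` suffices. Minimality of `p`
      -- excludes `weight b <ᴿ weight a`; the resulting bound on `weight a` then contradicts
      -- minimality of `q`.
      decidable-stable (≡-dec _≟_ p q) λ p≢q →
        let a , b , improve , improve′ = diverge path path′ sub sub′ p≢q in
        minimal⇒¬improvable min′ (improve (≤ᴿ⇒⊑ {weight a} {weight b} λ b<a →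
          minimal⇒¬improvable min (improve′ (<⇒⊑ {weight b} {weight a} b<a))))

  -- Encoding of paths by outgoing colours

  -- The value `zero` marks a vertex that the path does not leave.
  outColour : List (Fin m) → Fin n → Fin (suc k)
  outColour []       x = Fin.zero
  outColour (e ∷ es) x with source e ≟ x
  ... | yes _ = Fin.suc (colour e)
  ... | no  _ = outColour es x

  outColour-∈ : ∀ {u v p e} → IsPath G u v p → e ∈ p → outColour p (source e) ≡ Fin.suc (colour e)
  outColour-∈ {e = e} _ (here refl) with source e ≟ source e
  ... | yes _ = refl
  ... | no ≢  = contradiction refl ≢
  outColour-∈ {p = d ∷ _} {e} path (there e∈p) with source d ≟ source e
  ... | yes eq = contradiction (trans (sym eq) (source-head (proj₁ path))) (source≢start path e∈p)
  outColour-∈ (step _ walk , _ ∷ uniq) (there e∈p) | no _ = outColour-∈ (walk , uniq) e∈p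

  outColour-suc : ∀ p {x c} → outColour p x ≡ Fin.suc c →
    ∃ λ f → f ∈ p × source f ≡ x × colour f ≡ c
  outColour-suc (e ∷ es) {x} eq with source e ≟ x
  ... | yes src = e , here refl , src , Fin.suc-injective eq
  ... | no _ with f , f∈es , props ← outColour-suc es eq = f , there f∈es , props

  -- Every path leaves its start, so the colour there lies in `Fin k`, which gives the factor `k`
  -- instead of `suc k`.
  initialColour : ∀ {u v p} → IsWalk G u v p → Fin k
  initialColour (last {e = e} _ _) = colour e
  initialColour (step {e = e} _ _) = colour e

  outColour-start : ∀ {u v p} (walk : IsWalk G u v p) →
    outColour p u ≡ Fin.suc (initialColour walk)
  outColour-start {u} (last {e = e} src _) with source e ≟ u
  ... | yes _ = refl
  ... | no ≢  = contradiction src ≢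
  outColour-start {u} (step {e = e} src _) with source e ≟ u
  ... | yes _ = refl
  ... | no ≢  = contradiction src ≢

  outColour-≡⇒⊆ᵒ : ∀ {u v p q} → IsPath G u v p →
    (∀ x → x ≢ v → outColour p x ≡ outColour q x) → p ⊆ᵒ q
  outColour-≡⇒⊆ᵒ {q = q} path same {e} e∈p = outColour-suc q
    (trans (sym (same (source e) (source≢end path e∈p))) (outColour-∈ path e∈p))

-- Enumeration of the vertices and the final count

punchIn-cases : ∀ {n} {u v : Fin (suc (suc n))} (u≢v : u ≢ v) {P : Fin (suc (suc n)) → Set} →
  P u → (∀ j → P (punchIn u (punchIn (punchOut u≢v) j))) → ∀ x → x ≢ v → P x
punchIn-cases {u = u} {v} u≢v {P} Pu Pj x x≢v with u ≟ x
... | yes refl = Pu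
-- The vertex `u` is removed first and the renumbered `v` second; undoing both removals recovers
-- `x`.
... | no u≢x = subst P
  (trans (cong (punchIn u) (Fin.punchIn-punchOut v′≢x′)) (Fin.punchIn-punchOut u≢x))
  (Pj (punchOut v′≢x′))
  where
  v′≢x′ : punchOut u≢v ≢ punchOut u≢x
  v′≢x′ = x≢v ∘ sym ∘ Fin.punchOut-injective u≢v u≢x

funToFin-injective : ∀ {m n} (f g : Fin m → Fin n) → funToFin f ≡ funToFin g → ∀ i → f i ≡ g i
funToFin-injective f g eq i = begin
  f i                      ≡⟨ Fin.finToFun-funToFin f i ⟨
  finToFun (funToFin f) i  ≡⟨ cong (λ c → finToFun c i) eq ⟩
  finToFun (funToFin g) i  ≡⟨ Fin.finToFun-funToFin g i ⟩
  g i                      ∎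
  where open ≡-Reasoning

theorem3 : ∀ (n m k : ℕ) → 2 ≤ n →
    (G : WeightedColouredGraph n m k) → AtMostOneEdgePerColour G →
    ∀ (u v : Fin n) → u ≢ v →
    HasAtMost (k * (suc k ^ (n ∸ 2))) (IsMinimalPath G u v)
theorem3 (suc (suc n)) m k (ℕ.s≤s (ℕ.s≤s _)) G simple u v u≢v = injective-code⇒HasAtMost code code-injective
  where
  -- After the match on `2 ≤ n`, `n` is the number of vertices other than `u` and `v`.
  intermediate : Fin n → Fin (suc (suc n))
  intermediate j = punchIn u (punchIn (punchOut u≢v) j)

  code : ∀ {p} → IsMinimalPath G u v p → Fin (k * suc k ^ n)
  code {p} ((walk , _) , _) =
    combine (initialColour G walk) (funToFin (outColour G p ∘ intermediate))

  code-injective : ∀ {p q} (min : IsMinimalPath G u v p) (min′ : IsMinimalPath G u v q) →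
    code min ≡ code min′ → p ≡ q
  code-injective {p} {q} min@(path@(walk , _) , _) min′@(path′@(walk′ , _) , _) eq =
    minimal-unique G simple min min′
      (outColour-≡⇒⊆ᵒ G path same)
      (outColour-≡⇒⊆ᵒ G path′ λ x x≢v → sym (same x x≢v))
    where
    eqs : initialColour G walk ≡ initialColour G walk′ ×
      funToFin (outColour G p ∘ intermediate) ≡ funToFin (outColour G q ∘ intermediate)
    eqs = Fin.combine-injective (initialColour G walk) _ (initialColour G walk′) _ eq

    same : ∀ x → x ≢ v → outColour G p x ≡ outColour G q x
    same = punchIn-cases u≢v
      (trans (outColour-start G walk)
        (trans (cong Fin.suc (proj₁ eqs)) (sym (outColour-start G walk′))))
      (funToFin-injective _ _ (proj₂ eqs))
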